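{- Let $k=k(n)$ be an integer-valued function of $n$ with $k(n)\ge 2$ and $k(n)=o(\sqrt{n})$, and let $0<\beta < 1/2$. Let $c\ge 2$ (an integer) and $0<\varepsilon < 1/2$ be constants having the stability property described in the context, for $\alpha=1$ and this $\beta$. Then, for all large enough $n$, whenever $p$ is a prime, $A$ is a subset of $\mathbb{Z}_p$ with $|A|=n < (1 - \beta)p/2$, and $\mathcal{F} \subset A \times A$ satisfies $|\mathcal{F}|\le k(k-1)$ with $k=k(n)$, there is some $B'\subset A$ with $|B'|\le c$ such that $$|A+_{\mathcal{F}} B'|\ge 2n+1-2k.$$
   Context: $\mathbb{Z}_p$ is the cyclic group of prime order $p$. For $\mathcal{F}\subset A\times A$ (the set of forbidden pairs) and $B'\subset A$, the $\mathcal{F}$-restricted sum is $A+_{\mathcal{F}}B'=\{a+b : a\in A,\ b\in B',\ (a,b)\notin\mathcal{F}\}$. Stability property of $(c,\varepsilon)$ for given $\alpha,\beta>0$: for every prime $p$, all subsets $A,B$ of $\mathbb{Z}_p$ of size at least $2$ with $\alpha|B|\le|A|\le\alpha^{ -1}|B|$ and $|A|+|B|\le(1-\beta)p$, and every integer $r\le\varepsilon|B|$, if $|A+\{b_1,\dots,b_c\}|\le |A|+|B|-1+r$ for any $c$ elements $b_1,\dots,b_c\in B$, then $B$ is contained in an arithmetic progression of size $|B|+r$ in $\mathbb{Z}_p$. (It is a theorem of the paper that for all $\alpha,\beta>0$ such constants $c$ and $\varepsilon>0$ exist.) -}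

module Defs where

open import Data.Fin using (Fin; toℕ; combine; _≟_)
open import Data.Fin.Properties using (any?)
open import Data.Fin.Subset using (Subset; _∈_; _⊆_; ∣_∣)
open import Data.Fin.Subset.Properties using (_∈?_)
open import Data.Integer as ℤ using (ℤ; +_)
open import Data.Nat as ℕ using (ℕ; zero; suc)
open import Data.Nat.DivMod using (_mod_)
open import Data.Nat.Primality using (Prime)
open import Data.Product using (∃; ∃-syntax; _×_; _,_; map)
open import Data.Rational as ℚ using (ℚ; 0ℚ; 1ℚ; 1/_)
import Data.Rational.Properties as ℚₚ
open import Data.Rational.Solver using (module +-*-Solver)
open import Data.Sum using (_⊎_; inj₁; inj₂; swap)
open import Data.Vec using (tabulate)
open import Function.Base using (_∘_)
open import Function.Bundles using (_⇔_; mk⇔; Equivalence)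
open import Relation.Binary.Definitions using (tri<; tri≈; tri>)
open import Relation.Binary.PropositionalEquality
  using (_≡_; refl; sym; trans; cong; subst)
open import Relation.Nullary using (¬_; does)
open import Relation.Nullary.Decidable using (_×-dec_; ¬?)
open import Relation.Unary using (Decidable)

-- Two-sided Dedekind cuts, so that ε, α, β range over all real numbers.

record ℝ : Set₁ where
  field
    Lower Upper     : ℚ → Set
    lower-inhabited : ∃ Lower
    upper-inhabited : ∃ Upper
    lower-rounded   : ∀ q → Lower q ⇔ (∃[ r ] q ℚ.< r × Lower r)
    upper-rounded   : ∀ q → Upper q ⇔ (∃[ r ] r ℚ.< q × Upper r)
    disjoint        : ∀ q → ¬ (Lower q × Upper q)
    located         : ∀ {q r} → q ℚ.< r → Lower q ⊎ Upper r

open ℝ public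

infix 4 _<ᴿ_ _≤ᴿ_

_<ᴿ_ : ℝ → ℝ → Set
x <ᴿ y = ∃[ q ] Upper x q × Lower y q

_≤ᴿ_ : ℝ → ℝ → Set
x ≤ᴿ y = ∀ {q} → Lower x q → Lower y q

private
  q-1<q : ∀ q → q ℚ.- 1ℚ ℚ.< q
  q-1<q q = subst (q ℚ.- 1ℚ ℚ.<_) (ℚₚ.+-identityʳ q)
    (ℚₚ.+-monoʳ-< q (ℚₚ.neg-antimono-< (ℚₚ.positive⁻¹ 1ℚ)))

  q<q+1 : ∀ q → q ℚ.< q ℚ.+ 1ℚ
  q<q+1 q = subst (ℚ._< q ℚ.+ 1ℚ) (ℚₚ.+-identityʳ q)
    (ℚₚ.+-monoʳ-< q (ℚₚ.positive⁻¹ 1ℚ))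

fromℚ : ℚ → ℝ
fromℚ x .Lower = ℚ._< x
fromℚ x .Upper = x ℚ.<_
fromℚ x .lower-inhabited = x ℚ.- 1ℚ , q-1<q x
fromℚ x .upper-inhabited = x ℚ.+ 1ℚ , q<q+1 x
fromℚ x .lower-rounded q = mk⇔ ℚₚ.<-dense λ (_ , q<r , r<x) → ℚₚ.<-trans q<r r<x
fromℚ x .upper-rounded q =
  mk⇔ (λ x<q → let r , x<r , r<q = ℚₚ.<-dense x<q in r , r<q , x<r)
      (λ (_ , r<q , x<r) → ℚₚ.<-trans x<r r<q)
fromℚ x .disjoint q (q<x , x<q) = ℚₚ.<-asym q<x x<q
fromℚ x .located {q} {r} q<r with ℚₚ.<-cmp q x
... | tri< q<x _ _  = inj₁ q<x
... | tri≈ _ refl _ = inj₂ q<r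
... | tri> _ _ x<q  = inj₂ (ℚₚ.<-trans x<q q<r)

fromℤ : ℤ → ℝ
fromℤ i = fromℚ (i ℚ./ 1)

fromℕ : ℕ → ℝ
fromℕ m = fromℤ (+ m)

1-_ : ℝ → ℝ
1- x = record
  { Lower           = Upper x ∘ flip1
  ; Upper           = Lower x ∘ flip1
  ; lower-inhabited = map flip1 (reflect (Upper x)) (upper-inhabited x)
  ; upper-inhabited = map flip1 (reflect (Lower x)) (lower-inhabited x)
  ; lower-rounded   = λ q → mk⇔
      (λ u → let r , r<1-q , ur = to (upper-rounded x _) u
             in flip1 r , <-flipʳ r<1-q , reflect (Upper x) ur)
      (λ (r , q<r , ur) → from (upper-rounded x _) (flip1 r , flip1-anti q<r , ur))
  ; upper-rounded   = λ q → mk⇔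
      (λ l → let r , 1-q<r , lr = to (lower-rounded x _) l
             in flip1 r , <-flipˡ 1-q<r , reflect (Lower x) lr)
      (λ (r , r<q , lr) → from (lower-rounded x _) (flip1 r , flip1-anti r<q , lr))
  ; disjoint        = λ q (u , l) → disjoint x (flip1 q) (l , u)
  ; located         = swap ∘ located x ∘ flip1-anti
  }
  where
  open Equivalence using (to; from)

  flip1 : ℚ → ℚ
  flip1 q = 1ℚ ℚ.- q

  flip1-involutive : ∀ q → flip1 (flip1 q) ≡ q
  flip1-involutive = solve 1 (λ q → con 1ℚ :- (con 1ℚ :- q) := q) refl
    where open +-*-Solver

  flip1-anti : ∀ {q r} → q ℚ.< r → flip1 r ℚ.< flip1 q
  flip1-anti q<r = ℚₚ.+-monoʳ-< 1ℚ (ℚₚ.neg-antimono-< q<r)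

  <-flipʳ : ∀ {q r} → r ℚ.< flip1 q → q ℚ.< flip1 r
  <-flipʳ {q} r<1-q = subst (ℚ._< _) (flip1-involutive q) (flip1-anti r<1-q)

  <-flipˡ : ∀ {q r} → flip1 q ℚ.< r → flip1 r ℚ.< q
  <-flipˡ {q} 1-q<r = subst (_ ℚ.<_) (flip1-involutive q) (flip1-anti 1-q<r)

  reflect : ∀ (P : ℚ → Set) {q} → P q → P (flip1 (flip1 q))
  reflect P {q} = subst P (sym (flip1-involutive q))

infixr 7 _·_

_·_ : ℕ → ℝ → ℝ
zero  · x = fromℚ 0ℚ
suc m · x = record
  { Lower           = Lower x ∘ (_/s)
  ; Upper           = Upper x ∘ (_/s)
  ; lower-inhabited = map (ℚ._* s) (rescale (Lower x)) (lower-inhabited x)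
  ; upper-inhabited = map (ℚ._* s) (rescale (Upper x)) (upper-inhabited x)
  ; lower-rounded   = λ q → mk⇔
      (λ l → let r , q/s<r , lr = to (lower-rounded x _) l
             in r ℚ.* s , <-*s q/s<r , rescale (Lower x) lr)
      (λ (r , q<r , lr) → from (lower-rounded x _) (r /s , /s-mono q<r , lr))
  ; upper-rounded   = λ q → mk⇔
      (λ u → let r , r<q/s , ur = to (upper-rounded x _) u
             in r ℚ.* s , *s-< r<q/s , rescale (Upper x) ur)
      (λ (r , r<q , ur) → from (upper-rounded x _) (r /s , /s-mono r<q , ur))
  ; disjoint        = disjoint x ∘ (_/s)
  ; located         = located x ∘ /s-mono
  }
  where
  open Equivalence using (to; from)

  s : ℚ
  s = + suc m ℚ./ 1

  instance
    s-pos : ℚ.Positive s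
    s-pos = ℚₚ.normalize-pos (suc m) 1

    s-nonZero : ℚ.NonZero s
    s-nonZero = ℚₚ.pos⇒nonZero s

    1/s-pos : ℚ.Positive (1/ s)
    1/s-pos = ℚₚ.1/pos⇒pos s

  _/s : ℚ → ℚ
  q /s = q ℚ.* 1/ s

  *s/s : ∀ q → (q ℚ.* s) /s ≡ q
  *s/s q = trans (ℚₚ.*-assoc q s (1/ s))
    (trans (cong (q ℚ.*_) (ℚₚ.*-inverseʳ s)) (ℚₚ.*-identityʳ q))

  /s* : ∀ q → (q /s) ℚ.* s ≡ q
  /s* q = trans (ℚₚ.*-assoc q (1/ s) s)
    (trans (cong (q ℚ.*_) (ℚₚ.*-inverseˡ s)) (ℚₚ.*-identityʳ q))

  <-*s : ∀ {q r} → (q /s) ℚ.< r → q ℚ.< r ℚ.* s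
  <-*s {q} {r} q/s<r = subst (ℚ._< r ℚ.* s) (/s* q) (ℚₚ.*-monoˡ-<-pos s q/s<r)

  *s-< : ∀ {q r} → r ℚ.< (q /s) → r ℚ.* s ℚ.< q
  *s-< {q} {r} r<q/s = subst (r ℚ.* s ℚ.<_) (/s* q) (ℚₚ.*-monoˡ-<-pos s r<q/s)

  /s-mono : ∀ {q r} → q ℚ.< r → (q /s) ℚ.< (r /s)
  /s-mono = ℚₚ.*-monoˡ-<-pos (1/ s)

  rescale : ∀ (P : ℚ → Set) {q} → P q → P ((q ℚ.* s) /s)
  rescale P {q} = subst P (sym (*s/s q))

-- For every m, eventually m · k(n) ≤ √n; both sides are squared.

IsLittleO√ : (ℕ → ℕ) → Set
IsLittleO√ k = ∀ m → ∃[ N ] ∀ n → N ℕ.≤ n → (m ℕ.* k n) ℕ.^ 2 ℕ.≤ n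

-- ℤₙ is Fin n with addition and multiples modulo n.

infixl 6 _+ₙ_
infixl 7 _×ₙ_

_+ₙ_ : ∀ {n} → Fin n → Fin n → Fin n
_+ₙ_ {suc n} a b = (toℕ a ℕ.+ toℕ b) mod suc n

_×ₙ_ : ∀ {n} → ℕ → Fin n → Fin n
_×ₙ_ {suc n} i a = (i ℕ.* toℕ a) mod suc n

⟦_⟧ : ∀ {n} {P : Fin n → Set} → Decidable P → Subset n
⟦ P? ⟧ = tabulate (does ∘ P?)

range : ∀ {c n} → (Fin c → Fin n) → Subset n
range b = ⟦ (λ x → any? λ i → b i ≟ x) ⟧

infixl 6 _⊕_ _⊕[_]_

_⊕_ : ∀ {n} → Subset n → Subset n → Subset n
A ⊕ B = ⟦ (λ x → any? λ a → any? λ b →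
  a ∈? A ×-dec b ∈? B ×-dec a +ₙ b ≟ x) ⟧

-- Pairs are encoded by the bijection combine : Fin n × Fin n → Fin (n * n).

PairSet : ℕ → Set
PairSet n = Subset (n ℕ.* n)

_⊆_×ˢ_ : ∀ {n} → PairSet n → Subset n → Subset n → Set
F ⊆ A ×ˢ B = ∀ a b → combine a b ∈ F → a ∈ A × b ∈ B

_⊕[_]_ : ∀ {n} → Subset n → PairSet n → Subset n → Subset n
A ⊕[ F ] B = ⟦ (λ x → any? λ a → any? λ b →
  a ∈? A ×-dec b ∈? B ×-dec ¬? (combine a b ∈? F) ×-dec a +ₙ b ≟ x) ⟧

IsAP : ∀ {n} → Subset n → Set
IsAP {n} P = ∃[ a ] ∃[ d ] ∃[ m ] P ≡ range {m} {n} (λ i → a +ₙ toℕ i ×ₙ d)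

-- The bound |A| ≤ α⁻¹|B| is read as α|A| ≤ |B|.  The elements b₁, …, b_c need not
-- be distinct: with distinct ones the hypothesis on A + {b₁, …, b_c} would be
-- vacuous for |B| < c.

Stable : (c : ℕ) (ε α β : ℝ) → Set
Stable c ε α β =
  ∀ p → Prime p → (A B : Subset p) →
  2 ℕ.≤ ∣ A ∣ → 2 ℕ.≤ ∣ B ∣ →
  ∣ B ∣ · α ≤ᴿ fromℕ ∣ A ∣ → ∣ A ∣ · α ≤ᴿ fromℕ ∣ B ∣ →
  fromℕ (∣ A ∣ ℕ.+ ∣ B ∣) ≤ᴿ p · (1- β) →
  (r : ℤ) → fromℤ r ≤ᴿ ∣ B ∣ · ε →
  ((b : Fin c → Fin p) → (∀ i → b i ∈ B) →
    + ∣ A ⊕ range b ∣ ℤ.≤ + ∣ A ∣ ℤ.+ + ∣ B ∣ ℤ.- + 1 ℤ.+ r) →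
  ∃[ P ] IsAP P × B ⊆ P × + ∣ P ∣ ≡ + ∣ B ∣ ℤ.+ r

{-# OPTIONS --safe #-}

-- Suppose no B ⊆ A with |B| ≤ c works.  Deleting the forbidden pairs loses at most
-- |F| ≤ k(k−1) sums, so stability applies with B = A and r = k(k−1) = o(n), and A lies
-- in a progression of n + r ≤ p/2 terms.  There A can be sorted as x₀, …, xₙ₋₁ as if
-- in ℤ, and with Bᵤ = {xᵤ, xₙ₋₁₋ᵤ} there are at least 2n − 2u − 1 sums in A + Bᵤ.
-- If each Bᵤ with u < k fails, then F has at least 2(k−u) − 1 pairs with second element
-- in Bᵤ; the Bᵤ are disjoint, so |F| ≥ 1 + 3 + … + (2k−1) = k² > k(k−1).

module Submission where

open import Defs
open import Data.Empty using (⊥-elim)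
open import Data.Fin as Fin
  using (Fin; zero; suc; toℕ; combine; splitAt; join; inject≤; fromℕ<; opposite; remQuot)
open import Data.Fin.Properties as Finₚ
  using (any?; _≟_; <-cmp; injective⇒≤; join-splitAt; splitAt-join; suc-injective; remQuot-combine)
open import Data.Fin.Subset using (Subset; inside; outside; _∈_; _∉_; _⊆_; ∣_∣; _─_)
open import Data.Fin.Subset.Properties
  using (_∈?_; _⊆?_; anySubset?; p─q⊆p; x∈p∧x∉q⇒x∈p─q; p⊆q⇒∣p∣≤∣q∣)
open import Data.Integer as ℤ using (+_; +[1+_])
import Data.Integer.Properties as ℤₚ
open import Data.Nat
  using (ℕ; zero; suc; _+_; _*_; _∸_; _^_; _%_; _/_; _≤_; _<_; _≤?_; z≤n; s≤s; s≤s⁻¹; NonZero)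
open import Data.Nat.Divisibility using (_∣_; divides; ∣⇒≤)
open import Data.Nat.DivMod using (m≡m%n+[m/n]*n; %-distribˡ-+; m%n%n≡m%n; m%n<n)
open import Data.Nat.Primality using (Prime; euclidsLemma)
import Data.Nat.Properties as ℕₚ
open import Data.Nat.Tactic.RingSolver using (solve-∀)
open import Data.Product using (∃-syntax; _×_; _,_; proj₁; proj₂)
open import Data.Rational as ℚ using (ℚ; mkℚ; 0ℚ; ½; 1ℚ; 1/_; toℚᵘ)
import Data.Rational.Properties as ℚₚ
open import Data.Rational.Solver using (module +-*-Solver)
open import Data.Rational.Unnormalised as ℚᵘ using (mkℚᵘ)
import Data.Rational.Unnormalised.Properties as ℚᵘₚ
open import Data.Sum using (_⊎_; inj₁; inj₂; [_,_]′)
open import Data.Vec using (_∷_; here; there)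
open import Data.Vec.Properties using (lookup⇒[]=; []=⇒lookup; lookup∘tabulate)
open import Function.Base using (_∘_)
open import Function.Bundles using (Equivalence)
open import Function.Definitions using (Injective)
open import Relation.Binary.Definitions using (tri<; tri≈; tri>)
open import Relation.Binary.PropositionalEquality
  using (_≡_; _≢_; refl; sym; trans; cong; cong₂; subst; subst₂; module ≡-Reasoning)
open import Relation.Nullary using (¬_; Dec; does; yes; no; contradiction)
open import Relation.Nullary.Decidable using (dec-true; _×-dec_; ¬?)
open import Relation.Unary using (Decidable)

-- Counting in finite sets

∈⟦⟧⁺ : ∀ {n} {P : Fin n → Set} (P? : Decidable P) {x} → P x → x ∈ ⟦ P? ⟧
∈⟦⟧⁺ P? {x} px = lookup⇒[]= x _
  (trans (lookup∘tabulate (does ∘ P?) x) (dec-true (P? x) px))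

∈⟦⟧⁻ : ∀ {n} {P : Fin n → Set} (P? : Decidable P) {x} → x ∈ ⟦ P? ⟧ → P x
∈⟦⟧⁻ P? {x} x∈ with P? x | trans (sym (lookup∘tabulate (does ∘ P?) x)) ([]=⇒lookup x∈)
... | yes px | _ = px

∈range⁺ : ∀ {c n} (b : Fin c → Fin n) i → b i ∈ range b
∈range⁺ b i = ∈⟦⟧⁺ (λ x → any? λ i → b i ≟ x) (i , refl)

∈range⁻ : ∀ {c n} (b : Fin c → Fin n) {x} → x ∈ range b → ∃[ i ] b i ≡ x
∈range⁻ b = ∈⟦⟧⁻ (λ x → any? λ i → b i ≟ x)

∈⊕⁻ : ∀ {n} (A B : Subset n) {x} → x ∈ A ⊕ B →
  ∃[ a ] ∃[ b ] a ∈ A × b ∈ B × a +ₙ b ≡ x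
∈⊕⁻ A B = ∈⟦⟧⁻ (λ x → any? λ a → any? λ b → a ∈? A ×-dec b ∈? B ×-dec a +ₙ b ≟ x)

∈⊕[]⁺ : ∀ {n} {A B : Subset n} {F : PairSet n} {a b} →
  a ∈ A → b ∈ B → combine a b ∉ F → a +ₙ b ∈ A ⊕[ F ] B
∈⊕[]⁺ {A = A} {B} {F} a∈A b∈B ab∉F = ∈⟦⟧⁺
  (λ x → any? λ a → any? λ b →
    a ∈? A ×-dec b ∈? B ×-dec ¬? (combine a b ∈? F) ×-dec a +ₙ b ≟ x)
  (_ , _ , a∈A , b∈B , ab∉F , refl)

-- The increasing enumeration. Its image is all of `S`, so cardinality bounds become statements
-- about maps between types `Fin`.
element : ∀ {n} (S : Subset n) → Fin ∣ S ∣ → Fin n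
element (outside ∷ S) i       = suc (element S i)
element (inside  ∷ S) zero    = zero
element (inside  ∷ S) (suc i) = suc (element S i)

element-∈ : ∀ {n} (S : Subset n) i → element S i ∈ S
element-∈ (outside ∷ S) i       = there (element-∈ S i)
element-∈ (inside  ∷ S) zero    = here
element-∈ (inside  ∷ S) (suc i) = there (element-∈ S i)

element-mono-< : ∀ {n} (S : Subset n) {i j} → i Fin.< j → element S i Fin.< element S j
element-mono-< (outside ∷ S) i<j = s≤s (element-mono-< S i<j)
element-mono-< (inside  ∷ S) {zero}  {suc j} _         = s≤s z≤n
element-mono-< (inside  ∷ S) {suc i} {suc j} (s≤s i<j) = s≤s (element-mono-< S i<j)

element-surjective : ∀ {n} {S : Subset n} {x} → x ∈ S → ∃[ i ] element S i ≡ x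
element-surjective {S = inside ∷ S} here = zero , refl
element-surjective {S = outside ∷ S} (there x∈S) with i , refl ← element-surjective x∈S = i , refl
element-surjective {S = inside ∷ S} (there x∈S) with i , refl ← element-surjective x∈S = suc i , refl

mono-<⇒injective : ∀ {n} (σ : Fin n → ℕ) → (∀ {i j} → i Fin.< j → σ i < σ j) → Injective _≡_ _≡_ σ
mono-<⇒injective σ σ-mono {i} {j} eq with <-cmp i j
... | tri< i<j _ _ = contradiction eq (ℕₚ.<⇒≢ (σ-mono i<j))
... | tri≈ _ i≡j _ = i≡j
... | tri> _ _ j<i = contradiction (sym eq) (ℕₚ.<⇒≢ (σ-mono j<i))

element-injective : ∀ {n} (S : Subset n) → Injective _≡_ _≡_ (element S)
element-injective S eq = mono-<⇒injective (toℕ ∘ element S) (element-mono-< S) (cong toℕ eq)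

-- Pigeonhole: choosing for each `j` a preimage of `h j` under `w` gives an injection
-- `Fin q → Fin r`, since applying `w` recovers `h j`.
injective∧covered⇒≤ : ∀ {q r} {X : Set} {h : Fin q → X} → Injective _≡_ _≡_ h →
  (w : Fin r → X) → (∀ j → ∃[ i ] w i ≡ h j) → q ≤ r
injective∧covered⇒≤ h-inj w cov = injective⇒≤ λ {i} {j} eq →
  h-inj (trans (sym (proj₂ (cov i))) (trans (cong w eq) (proj₂ (cov j))))

injective⇒≤∣∣ : ∀ {q n} (T : Subset n) {h : Fin q → Fin n} → Injective _≡_ _≡_ h →
  (∀ j → h j ∈ T) → q ≤ ∣ T ∣
injective⇒≤∣∣ T h-inj h∈T = injective∧covered⇒≤ h-inj (element T) (element-surjective ∘ h∈T)

covered⇒∣∣≤ : ∀ {r n} (S : Subset n) (w : Fin r → Fin n) →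
  (∀ {x} → x ∈ S → ∃[ i ] w i ≡ x) → ∣ S ∣ ≤ r
covered⇒∣∣≤ S w cov = injective∧covered⇒≤ (element-injective S) w (cov ∘ element-∈ S)

-- Each `h j` is charged to an element of `T` or of `F`: the list of `T` followed by the `g`-values
-- on `F` covers the family. In use, `T` is a restricted sumset and `g` sends a forbidden pair to
-- its sum.
injective⇒≤∣∣+∣∣ : ∀ {q n m} (T : Subset n) (F : Subset m) (g : Fin m → Fin n) {h : Fin q → Fin n} →
  Injective _≡_ _≡_ h → (∀ j → h j ∈ T ⊎ (∃[ z ] z ∈ F × g z ≡ h j)) → q ≤ ∣ T ∣ + ∣ F ∣
injective⇒≤∣∣+∣∣ T F g {h} h-inj h∈ = injective∧covered⇒≤ h-inj w cov
  where
  w′ : Fin ∣ T ∣ ⊎ Fin ∣ F ∣ → Fin _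
  w′ = [ element T , g ∘ element F ]′

  w : Fin (∣ T ∣ + ∣ F ∣) → Fin _
  w = w′ ∘ splitAt ∣ T ∣

  cov′ : ∀ j → ∃[ s ] w′ s ≡ h j
  cov′ j with h∈ j
  ... | inj₁ hj∈T with i , eq ← element-surjective hj∈T = inj₁ i , eq
  ... | inj₂ (z , z∈F , eq) with i , refl ← element-surjective z∈F = inj₂ i , eq

  cov : ∀ j → ∃[ i ] w i ≡ h j
  cov j = let s , eq = cov′ j in
    join _ _ s , trans (cong w′ (splitAt-join ∣ T ∣ ∣ F ∣ s)) eq

[,]-splitAt-injective : ∀ {m n} {X : Set} {f : Fin m → X} {g : Fin n → X} →
  Injective _≡_ _≡_ f → Injective _≡_ _≡_ g → (∀ i j → f i ≢ g j) →
  Injective _≡_ _≡_ ([ f , g ]′ ∘ splitAt m)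
[,]-splitAt-injective {m} {n} {f = f} {g} f-inj g-inj f≢g {i} {j} eq =
  trans (sym (join-splitAt m n i))
    (trans (cong (join m n) (inj (splitAt m i) (splitAt m j) eq)) (join-splitAt m n j))
  where
  inj : ∀ s t → [ f , g ]′ s ≡ [ f , g ]′ t → s ≡ t
  inj (inj₁ i) (inj₁ j) eq = cong inj₁ (f-inj eq)
  inj (inj₁ i) (inj₂ j) eq = contradiction eq (f≢g i j)
  inj (inj₂ i) (inj₁ j) eq = contradiction (sym eq) (f≢g j i)
  inj (inj₂ i) (inj₂ j) eq = cong inj₂ (g-inj eq)

disjoint⇒∣∣+∣∣≤ : ∀ {n} (S T U : Subset n) → S ⊆ U → T ⊆ U → (∀ {x} → x ∈ S → x ∉ T) →
  ∣ S ∣ + ∣ T ∣ ≤ ∣ U ∣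
disjoint⇒∣∣+∣∣≤ S T U S⊆U T⊆U S∩T≡∅ = injective⇒≤∣∣ U
  ([,]-splitAt-injective (element-injective S) (element-injective T)
    λ i j eq → S∩T≡∅ (element-∈ S i) (subst (_∈ T) (sym eq) (element-∈ T j)))
  (λ j → ∈U (splitAt ∣ S ∣ j))
  where
  ∈U : ∀ s → [ element S , element T ]′ s ∈ U
  ∈U (inj₁ i) = S⊆U (element-∈ S i)
  ∈U (inj₂ i) = T⊆U (element-∈ T i)

∣range∣≤ : ∀ {c n} (b : Fin c → Fin n) → ∣ range b ∣ ≤ c
∣range∣≤ b = covered⇒∣∣≤ (range b) b (∈range⁻ b)

-- Restricted sums of an increasing sequence

x∈p─q⇒x∉q : ∀ {n} (p q : Subset n) {x} → x ∈ p ─ q → x ∉ q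
x∈p─q⇒x∉q (_ ∷ p) (outside ∷ q) here ()
x∈p─q⇒x∉q (_ ∷ p) (_ ∷ q) (there x∈) (there x∈q) = x∈p─q⇒x∉q p q x∈ x∈q

-- The last hypothesis means `∣ G u ∣ ≥ 2(k − u) − 1`, written without subtraction. Peeling off
-- `G zero`, which has at least `2k − 1` elements, leaves a family of the same shape for `k − 1` in
-- the rest of `F`, and `k² = (k − 1)² + (2k − 1)`.
disjoint-odd⇒square≤ : ∀ {N} k (F : Subset N) (G : Fin k → Subset N) → (∀ u → G u ⊆ F) →
  (∀ {u v x} → x ∈ G u → x ∈ G v → u ≡ v) →
  (∀ u → 2 * k ≤ ∣ G u ∣ + suc (2 * toℕ u)) → k * k ≤ ∣ F ∣
disjoint-odd⇒square≤ zero F G G⊆F disj odd = z≤n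
disjoint-odd⇒square≤ (suc k) F G G⊆F disj odd = begin
  suc k * suc k               ≡⟨ square-suc k ⟩
  k * k + suc (2 * k)         ≤⟨ ℕₚ.+-mono-≤ rest first ⟩
  ∣ F ─ G zero ∣ + ∣ G zero ∣ ≤⟨ disjoint⇒∣∣+∣∣≤ (F ─ G zero) (G zero) F
                                   (p─q⊆p F (G zero)) (G⊆F zero) (x∈p─q⇒x∉q F (G zero)) ⟩
  ∣ F ∣                       ∎
  where
  open ℕₚ.≤-Reasoning
  square-suc : ∀ k → suc k * suc k ≡ k * k + suc (2 * k)
  square-suc = solve-∀

  first : suc (2 * k) ≤ ∣ G zero ∣
  first = s≤s⁻¹ (subst₂ _≤_ (ℕₚ.*-suc 2 k) (ℕₚ.+-comm ∣ G zero ∣ 1) (odd zero))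

  shift : ∀ g u → g + suc (2 * suc u) ≡ 2 + (g + suc (2 * u))
  shift = solve-∀

  rest : k * k ≤ ∣ F ─ G zero ∣
  rest = disjoint-odd⇒square≤ k (F ─ G zero) (G ∘ suc)
    (λ u x∈ → x∈p∧x∉q⇒x∈p─q (G⊆F (suc u) x∈) λ x∈₀ → Finₚ.0≢1+n (disj x∈₀ x∈))
    (λ x∈u x∈v → suc-injective (disj x∈u x∈v))
    λ u → ℕₚ.+-cancelˡ-≤ 2 _ _
      (subst₂ _≤_ (ℕₚ.*-suc 2 k) (shift ∣ G (suc u) ∣ (toℕ u)) (odd (suc u)))

infixl 6 _⇂_

-- Forbidden pairs with second component in `B`, the only ones that can remove a sum from `A ⊕ B`.
-- `remQuot` inverts `combine`.
_⇂_ : ∀ {p} → PairSet p → Subset p → PairSet p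
_⇂_ {p} F B = ⟦ (λ z → z ∈? F ×-dec proj₂ (remQuot {p} p z) ∈? B) ⟧

∈⇂⁻ : ∀ {p} (F : PairSet p) (B : Subset p) {z} → z ∈ F ⇂ B → z ∈ F × proj₂ (remQuot {p} p z) ∈ B
∈⇂⁻ {p} F B = ∈⟦⟧⁻ (λ z → z ∈? F ×-dec proj₂ (remQuot {p} p z) ∈? B)

pairSum : ∀ {p} → Fin (p * p) → Fin p
pairSum {p} z = proj₁ (remQuot {p} p z) +ₙ proj₂ (remQuot {p} p z)

sum-or-forbidden : ∀ {p} (A : Subset p) (F : PairSet p) (B : Subset p) {a b} → a ∈ A → b ∈ B →
  a +ₙ b ∈ A ⊕[ F ] B ⊎ (∃[ z ] z ∈ F ⇂ B × pairSum z ≡ a +ₙ b)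
sum-or-forbidden {p} A F B {a} {b} a∈A b∈B with combine a b ∈? F
... | no ab∉F = inj₁ (∈⊕[]⁺ a∈A b∈B ab∉F)
... | yes ab∈F = inj₂ (combine a b ,
  ∈⟦⟧⁺ (λ z → z ∈? F ×-dec proj₂ (remQuot {p} p z) ∈? B)
    (ab∈F , subst (_∈ B) (sym (cong proj₂ (remQuot-combine a b))) b∈B) ,
  cong (λ (a , b) → a +ₙ b) (remQuot-combine a b))

-- Every sum lost by the restriction is the `pairSum` of a forbidden pair, and distinct lost sums
-- come from distinct pairs.
∣⊕∣≤∣⊕[]∣+∣∣ : ∀ {p} (A : Subset p) (F : PairSet p) (B : Subset p) → ∣ A ⊕ B ∣ ≤ ∣ A ⊕[ F ] B ∣ + ∣ F ∣
∣⊕∣≤∣⊕[]∣+∣∣ A F B = ℕₚ.≤-trans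
  (injective⇒≤∣∣+∣∣ (A ⊕[ F ] B) (F ⇂ B) pairSum (element-injective (A ⊕ B)) covered)
  (ℕₚ.+-monoʳ-≤ _ (p⊆q⇒∣p∣≤∣q∣ (proj₁ ∘ ∈⇂⁻ F B)))
  where
  covered : ∀ j → element (A ⊕ B) j ∈ A ⊕[ F ] B ⊎ (∃[ z ] z ∈ F ⇂ B × pairSum z ≡ element (A ⊕ B) j)
  covered j with _ , _ , a∈A , b∈B , eq ← ∈⊕⁻ A B (element-∈ (A ⊕ B) j) =
    subst (λ x → x ∈ A ⊕[ F ] B ⊎ (∃[ z ] z ∈ F ⇂ B × pairSum z ≡ x)) eq
      (sum-or-forbidden A F B a∈A b∈B)

side : ∀ {n} → Fin n → Fin 2 → Fin n
side u zero       = u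
side u (suc zero) = opposite u

opposite-sum : ∀ {n} (u : Fin n) → suc (toℕ u + toℕ (opposite u)) ≡ n
opposite-sum u = trans (cong (λ v → suc (toℕ u) + v) (Finₚ.opposite-prop u)) (ℕₚ.m+[n∸m]≡n (Finₚ.toℕ<n u))

-- Indices below `k` and their opposites never meet: `opposite u ≡ v` would give
-- `n = u + v + 1 < 2k ≤ n`.
side-determines : ∀ {n k} {u v : Fin n} → 2 * k ≤ n → toℕ u < k → toℕ v < k →
  ∀ i j → side u i ≡ side v j → u ≡ v
side-determines {n} {k} {u} {v} 2k≤n u<k v<k = λ where
    zero zero eq → eq
    zero (suc zero) eq → contradiction (sym eq) (apart v<k u<k)
    (suc zero) zero eq → contradiction eq (apart u<k v<k)
    (suc zero) (suc zero) eq → trans (sym (Finₚ.opposite-involutive u))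
      (trans (cong opposite eq) (Finₚ.opposite-involutive v))
  where
  open ℕₚ.≤-Reasoning
  apart : ∀ {u v : Fin n} → toℕ u < k → toℕ v < k → opposite u ≢ v
  apart {u} {v} u<k v<k eq = ℕₚ.<-irrefl refl (begin-strict
    n                          ≡⟨ opposite-sum u ⟨
    suc (toℕ u + toℕ (opposite u)) ≡⟨ cong (λ w → suc (toℕ u + toℕ w)) eq ⟩
    suc (toℕ u + toℕ v) <⟨ s≤s (ℕₚ.≤-reflexive (sym (ℕₚ.+-suc (toℕ u) (toℕ v)))) ⟩
    suc (toℕ u) + suc (toℕ v) ≤⟨ ℕₚ.+-mono-≤ u<k v<k ⟩
    k + k ≡⟨ cong (λ l → k + l) (ℕₚ.+-identityʳ k) ⟨
    2 * k ≤⟨ 2k≤n ⟩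
    n ∎)

-- Here `σ` lifts the sequence `x` from `ℤₚ` to the integers, and `sum-reflects` is the half of the
-- Freiman isomorphism condition that carries distinctness of sums from the integers back to `ℤₚ`.
module IncreasingSums {n p} (x : Fin n → Fin p) (σ : Fin n → ℕ)
  (σ-mono-< : ∀ {i j} → i Fin.< j → σ i < σ j)
  (sum-reflects : ∀ {i j i′ j′} → x i +ₙ x j ≡ x i′ +ₙ x j′ → σ i + σ j ≡ σ i′ + σ j′)
  where

  σ-injective : Injective _≡_ _≡_ σ
  σ-injective = mono-<⇒injective σ σ-mono-<

  σ-mono-≤ : ∀ {i j} → i Fin.≤ j → σ i ≤ σ j
  σ-mono-≤ {i} {j} i≤j with ℕₚ.m≤n⇒m<n∨m≡n i≤j
  ... | inj₁ i<j = ℕₚ.<⇒≤ (σ-mono-< i<j)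
  ... | inj₂ i≡j = ℕₚ.≤-reflexive (cong σ (Finₚ.toℕ-injective i≡j))

  -- Equal terms have equal doubles, and `sum-reflects` turns these into `2 σ i = 2 σ j`.
  x-injective : Injective _≡_ _≡_ x
  x-injective {i} {j} eq =
    σ-injective (ℕₚ.*-cancelˡ-≡ (σ i) (σ j) 2 (trans (double (σ i))
      (trans (sum-reflects (cong₂ _+ₙ_ eq eq)) (sym (double (σ j))))))
    where
    double : ∀ m → 2 * m ≡ m + m
    double = solve-∀

  sum-cancelʳ : ∀ {i i′} j → x i +ₙ x j ≡ x i′ +ₙ x j → i ≡ i′
  sum-cancelʳ j eq = σ-injective (ℕₚ.+-cancelʳ-≡ (σ j) _ _ (sum-reflects eq))

  ends : Fin n → Subset p
  ends u = range (x ∘ side u)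

  -- With v = opposite u, the 2v + 1 sums
  -- x₀ + x_u, …, x_v + x_u, x_{u+1} + x_v, …, x_{n-1} + x_v are distinct.
  ends-sums : ∀ (A : Subset p) (F : PairSet p) → (∀ i → x i ∈ A) → ∀ u →
    suc (toℕ (opposite u)) + toℕ (opposite u) ≤ ∣ A ⊕[ F ] ends u ∣ + ∣ F ⇂ ends u ∣
  ends-sums A F x∈A u = injective⇒≤∣∣+∣∣ (A ⊕[ F ] ends u) (F ⇂ ends u) pairSum
    ([,]-splitAt-injective {suc (toℕ v)} {toℕ v} {f = λ j → x (low j) +ₙ x u} {λ j → x (high j) +ₙ x v}
      (λ {i} {j} eq → Finₚ.inject≤-injective v<n v<n i j (sum-cancelʳ u eq))
      (λ {i} {j} eq → Finₚ.toℕ-injective (ℕₚ.+-cancelˡ-≡ (suc (toℕ u)) _ _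
        (trans (sym (toℕ-high i)) (trans (cong toℕ (sum-cancelʳ v eq)) (toℕ-high j)))))
      λ i j eq → ℕₚ.<⇒≢ (low<high i j) (sum-reflects eq))
    (λ j → covered (splitAt (suc (toℕ v)) j))
    where
    v : Fin n
    v = opposite u

    v<n : toℕ v < n
    v<n = Finₚ.toℕ<n v

    low : Fin (suc (toℕ v)) → Fin n
    low j = inject≤ j v<n

    high-< : ∀ (j : Fin (toℕ v)) → suc (toℕ u) + toℕ j < n
    high-< j = subst (suc (toℕ u) + toℕ j <_) (opposite-sum u)
      (ℕₚ.+-monoʳ-< (suc (toℕ u)) (Finₚ.toℕ<n j))

    high : Fin (toℕ v) → Fin n
    high j = fromℕ< (high-< j)

    toℕ-high : ∀ j → toℕ (high j) ≡ suc (toℕ u) + toℕ j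
    toℕ-high j = Finₚ.toℕ-fromℕ< (high-< j)

    -- The two families do not meet: `low i ≤ v` and `u < high j`, so in terms of `σ` the first lies
    -- strictly below the second.
    low<high : ∀ i j → σ (low i) + σ u < σ (high j) + σ v
    low<high i j = subst (σ (low i) + σ u <_) (ℕₚ.+-comm (σ v) (σ (high j)))
      (ℕₚ.+-mono-≤-<
        (σ-mono-≤ (subst (_≤ toℕ v) (sym (Finₚ.toℕ-inject≤ i v<n)) (s≤s⁻¹ (Finₚ.toℕ<n i))))
        (σ-mono-< (subst (toℕ u <_) (sym (toℕ-high j)) (ℕₚ.m≤m+n _ (toℕ j)))))

    covered : ∀ s → let y = [ (λ j → x (low j) +ₙ x u) , (λ j → x (high j) +ₙ x v) ]′ s in
      y ∈ A ⊕[ F ] ends u ⊎ (∃[ z ] z ∈ F ⇂ ends u × pairSum z ≡ y)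
    covered (inj₁ j) = sum-or-forbidden A F (ends u) (x∈A (low j)) (∈range⁺ (x ∘ side u) zero)
    covered (inj₂ j) = sum-or-forbidden A F (ends u) (x∈A (high j)) (∈range⁺ (x ∘ side u) (suc zero))

  ∃-good-ends : ∀ (A : Subset p) (F : PairSet p) → (∀ i → x i ∈ A) → ∀ k → 2 * k ≤ n → ∣ F ∣ < k * k →
    ∃[ u ] 2 * n + 1 ≤ ∣ A ⊕[ F ] ends u ∣ + 2 * k
  ∃-good-ends A F x∈A k 2k≤n ∣F∣<k² with any? (λ u → 2 * n + 1 ≤? ∣ A ⊕[ F ] ends u ∣ + 2 * k)
  ... | yes good = good
  ... | no ¬good = contradiction
    (disjoint-odd⇒square≤ k F (λ u → F ⇂ ends (ι u)) (λ u → proj₁ ∘ ∈⇂⁻ F (ends (ι u))) ends-disjoint odd)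
    (ℕₚ.<⇒≱ ∣F∣<k²)
    where
    open ℕₚ.≤-Reasoning

    k≤n : k ≤ n
    k≤n = ℕₚ.≤-trans (ℕₚ.m≤m+n k (k + 0)) 2k≤n

    ι : Fin k → Fin n
    ι u = inject≤ u k≤n

    ι<k : ∀ u → toℕ (ι u) < k
    ι<k u = subst (_< k) (sym (Finₚ.toℕ-inject≤ u k≤n)) (Finₚ.toℕ<n u)

    -- A pair in both sets has a single second component, which `x-injective` turns into a common
    -- index of the two ends.
    ends-disjoint : ∀ {u v z} → z ∈ F ⇂ ends (ι u) → z ∈ F ⇂ ends (ι v) → u ≡ v
    ends-disjoint {u} {v} z∈u z∈v
      with i , eq₁ ← ∈range⁻ (x ∘ side (ι u)) (proj₂ (∈⇂⁻ F (ends (ι u)) z∈u))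
         | j , eq₂ ← ∈range⁻ (x ∘ side (ι v)) (proj₂ (∈⇂⁻ F (ends (ι v)) z∈v)) =
      Finₚ.inject≤-injective k≤n k≤n u v
        (side-determines 2k≤n (ι<k u) (ι<k v) i j (x-injective (trans eq₁ (sym eq₂))))

    -- With `V = n − 1 − u`, `ends-sums` gives `2V + 1 ≤ S + f`, and the failure of `ends (ι u)`
    -- gives `S + 2k ≤ 2n`. Adding eliminates `S`, and `2n = (2V + 1) + (2u + 1)` leaves the claim.
    odd : ∀ u → 2 * k ≤ ∣ F ⇂ ends (ι u) ∣ + suc (2 * toℕ u)
    odd u = ℕₚ.+-cancelˡ-≤ (suc V + V) _ _ (begin
      suc V + V + 2 * k ≤⟨ ℕₚ.+-monoˡ-≤ (2 * k) (ends-sums A F x∈A (ι u)) ⟩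
      S + f + 2 * k     ≡⟨ swap S f (2 * k) ⟩
      S + 2 * k + f     ≤⟨ ℕₚ.+-monoˡ-≤ f (s≤s⁻¹ (subst (S + 2 * k <_) (ℕₚ.+-comm (2 * n) 1)
                             (ℕₚ.≰⇒> λ le → ¬good (ι u , le)))) ⟩
      2 * n + f         ≡⟨ cong (λ m → 2 * m + f) (opposite-sum (ι u)) ⟨
      2 * suc (toℕ (ι u) + V) + f ≡⟨ cong (λ w → 2 * suc (w + V) + f) (Finₚ.toℕ-inject≤ u k≤n) ⟩
      2 * suc (toℕ u + V) + f ≡⟨ regroup (toℕ u) V f ⟩
      suc V + V + (f + suc (2 * toℕ u)) ∎)
      where
      V = toℕ (opposite (ι u))
      S = ∣ A ⊕[ F ] ends (ι u) ∣
      f = ∣ F ⇂ ends (ι u) ∣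

      swap : ∀ a b c → a + b + c ≡ a + c + b
      swap = solve-∀

      regroup : ∀ u v f → 2 * suc (u + v) + f ≡ suc v + v + (f + suc (2 * u))
      regroup = solve-∀

-- Arithmetic progressions in ℤₚ

-- Cancelling the common remainder leaves a multiple of `d`. Truncated subtraction keeps this true
-- for `m < n`, where both differences vanish.
%≡%⇒∣∸ : ∀ m n d .{{_ : NonZero d}} → m % d ≡ n % d → d ∣ m ∸ n
%≡%⇒∣∸ m n d eq = divides (m / d ∸ n / d) (begin
  m ∸ n                                     ≡⟨ cong₂ _∸_ (m≡m%n+[m/n]*n m d) (m≡m%n+[m/n]*n n d) ⟩
  (m % d + m / d * d) ∸ (n % d + n / d * d) ≡⟨ cong (λ r → (r + m / d * d) ∸ (n % d + n / d * d)) eq ⟩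
  (n % d + m / d * d) ∸ (n % d + n / d * d) ≡⟨ ℕₚ.[m+n]∸[m+o]≡n∸o (n % d) _ _ ⟩
  m / d * d ∸ n / d * d                     ≡⟨ ℕₚ.*-distribʳ-∸ d (m / d) (n / d) ⟨
  (m / d ∸ n / d) * d                       ∎)
  where open ≡-Reasoning

∣∧<⇒≡0 : ∀ {d m} → d ∣ m → m < d → m ≡ 0
∣∧<⇒≡0 {m = zero}  d∣m m<d = refl
∣∧<⇒≡0 {m = suc _} d∣m m<d = contradiction (∣⇒≤ d∣m) (ℕₚ.<⇒≱ m<d)

-- `p` divides `(i ∸ j) * d`, so Euclid's lemma and `i < p` force `i ∸ j` to vanish. This yields
-- only `i ≤ j`; the symmetric half completes the equality.
affine-injective : ∀ {p} .{{_ : NonZero p}} → Prime p → ∀ {d} → ¬ p ∣ d → ∀ x {i j} → i < p → j < p →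
  (x + i * d) % p ≡ (x + j * d) % p → i ≡ j
affine-injective {p} p-prime {d} p∤d x i<p j<p eq = ℕₚ.≤-antisym (half i<p eq) (half j<p (sym eq))
  where
  half : ∀ {i j} → i < p → (x + i * d) % p ≡ (x + j * d) % p → i ≤ j
  half {i} {j} i<p eq with euclidsLemma (i ∸ j) d p-prime
    (subst (p ∣_) (trans (ℕₚ.[m+n]∸[m+o]≡n∸o x (i * d) (j * d)) (sym (ℕₚ.*-distribʳ-∸ d i j)))
      (%≡%⇒∣∸ (x + i * d) (x + j * d) p eq))
  ... | inj₁ p∣i∸j = ℕₚ.m∸n≡0⇒m≤n (∣∧<⇒≡0 p∣i∸j (ℕₚ.≤-<-trans (ℕₚ.m∸n≤m i j) i<p))
  ... | inj₂ p∣d   = contradiction p∣d p∤d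

toℕ-+ₙ : ∀ {p} (a b : Fin (suc p)) → toℕ (a +ₙ b) ≡ (toℕ a + toℕ b) % suc p
toℕ-+ₙ a b = Finₚ.toℕ-fromℕ< (m%n<n (toℕ a + toℕ b) _)

[m+n%d]%d≡[m+n]%d : ∀ m n d .{{_ : NonZero d}} → (m + n % d) % d ≡ (m + n) % d
[m+n%d]%d≡[m+n]%d m n d = begin
  (m + n % d) % d           ≡⟨ %-distribˡ-+ m (n % d) d ⟩
  (m % d + n % d % d) % d   ≡⟨ cong (λ r → (m % d + r) % d) (m%n%n≡m%n n d) ⟩
  (m % d + n % d) % d       ≡⟨ %-distribˡ-+ m n d ⟨
  (m + n) % d               ∎
  where open ≡-Reasoning

toℕ-term : ∀ {p} (a d : Fin (suc p)) i → toℕ (a +ₙ i ×ₙ d) ≡ (toℕ a + i * toℕ d) % suc p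
toℕ-term {p} a d i = begin
  toℕ (a +ₙ i ×ₙ d)                        ≡⟨ toℕ-+ₙ a (i ×ₙ d) ⟩
  (toℕ a + toℕ (i ×ₙ d)) % suc p           ≡⟨ cong (λ r → (toℕ a + r) % suc p)
                                                (Finₚ.toℕ-fromℕ< (m%n<n (i * toℕ d) (suc p))) ⟩
  (toℕ a + (i * toℕ d) % suc p) % suc p    ≡⟨ [m+n%d]%d≡[m+n]%d (toℕ a) (i * toℕ d) (suc p) ⟩
  (toℕ a + i * toℕ d) % suc p              ∎
  where open ≡-Reasoning

-- Sums of two terms again form a progression with difference `d`, indexed by `i + j`, so
-- `affine-injective` recovers `i + j` while it stays below the modulus.
toℕ-term+term : ∀ {p} (a d : Fin (suc p)) i j →
  toℕ ((a +ₙ i ×ₙ d) +ₙ (a +ₙ j ×ₙ d)) ≡ (toℕ a + toℕ a + (i + j) * toℕ d) % suc p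
toℕ-term+term {p} a d i j = begin
  toℕ ((a +ₙ i ×ₙ d) +ₙ (a +ₙ j ×ₙ d))                      ≡⟨ toℕ-+ₙ (a +ₙ i ×ₙ d) (a +ₙ j ×ₙ d) ⟩
  (toℕ (a +ₙ i ×ₙ d) + toℕ (a +ₙ j ×ₙ d)) % suc p           ≡⟨ cong₂ (λ r s → (r + s) % suc p)
                                                                 (toℕ-term a d i) (toℕ-term a d j) ⟩
  ((x + i * y) % suc p + (x + j * y) % suc p) % suc p       ≡⟨ %-distribˡ-+ (x + i * y) (x + j * y) (suc p) ⟨
  (x + i * y + (x + j * y)) % suc p                         ≡⟨ cong (_% suc p) (regroup x y i j) ⟩
  (x + x + (i + j) * y) % suc p                             ∎
  where
  open ≡-Reasoning
  x = toℕ a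
  y = toℕ d
  regroup : ∀ x y i j → x + i * y + (x + j * y) ≡ x + x + (i + j) * y
  regroup = solve-∀

-- Positions in the progression serve as `σ` in `IncreasingSums`: two of them add up to less than
-- `2 * ∣ P ∣ ≤ p`, so a sum in `ℤₚ` determines the sum of the positions.
∃-large-restricted-sum : ∀ {p} → Prime p → (A P : Subset p) → IsAP P → A ⊆ P →
  2 ≤ ∣ A ∣ → 2 * ∣ P ∣ ≤ p →
  (F : PairSet p) → ∀ k → 2 * k ≤ ∣ A ∣ → ∣ F ∣ < k * k →
  ∃[ B ] B ⊆ A × ∣ B ∣ ≤ 2 × 2 * ∣ A ∣ + 1 ≤ ∣ A ⊕[ F ] B ∣ + 2 * k
∃-large-restricted-sum {suc p} p-prime A P (a , d , m , refl) A⊆P 2≤∣A∣ 2∣P∣≤p F k 2k≤∣A∣ ∣F∣<k² =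
  let u , large = ∃-good-ends A F x∈A k (ℕₚ.≤-trans 2k≤∣A∣ ∣A∣≤∣S∣) ∣F∣<k² in
  ends u , ends⊆A u , ∣range∣≤ (x ∘ side u) ,
  ℕₚ.≤-trans (ℕₚ.+-monoˡ-≤ 1 (ℕₚ.*-monoʳ-≤ 2 ∣A∣≤∣S∣)) large
  where
  term : Fin m → Fin (suc p)
  term i = a +ₙ toℕ i ×ₙ d

  2≤∣P∣ : 2 ≤ ∣ P ∣
  2≤∣P∣ = ℕₚ.≤-trans 2≤∣A∣ (p⊆q⇒∣p∣≤∣q∣ A⊆P)

  constant : toℕ d ≡ 0 → ∀ i → a +ₙ i ×ₙ d ≡ a +ₙ 0 ×ₙ d
  constant d≡0 i = Finₚ.toℕ-injective (trans (toℕ-term a d i)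
    (trans (cong (λ r → (toℕ a + r) % suc p) (trans (cong (i *_) d≡0) (ℕₚ.*-zeroʳ i)))
      (sym (toℕ-term a d 0))))

  -- With zero difference all terms coincide, but `P` has at least two elements.
  d≢0 : toℕ d ≢ 0
  d≢0 d≡0 = ℕₚ.<⇒≱ 2≤∣P∣ (covered⇒∣∣≤ {r = 1} P (λ _ → a +ₙ 0 ×ₙ d) λ x∈P →
    let i , eq = ∈range⁻ term x∈P in zero , trans (sym (constant d≡0 (toℕ i))) eq)

  p∤d : ¬ suc p ∣ toℕ d
  p∤d p∣d = d≢0 (∣∧<⇒≡0 p∣d (Finₚ.toℕ<n d))

  term-injective : ∀ {i j} → i < suc p → j < suc p → a +ₙ i ×ₙ d ≡ a +ₙ j ×ₙ d → i ≡ j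
  term-injective {i} {j} i<p j<p eq = affine-injective p-prime p∤d (toℕ a) i<p j<p
    (trans (sym (toℕ-term a d i)) (trans (cong toℕ eq) (toℕ-term a d j)))

  initial≤∣P∣ : ∀ {l} → l ≤ m → l ≤ suc p → l ≤ ∣ P ∣
  initial≤∣P∣ {l} l≤m l≤p = injective⇒≤∣∣ P {h = λ i → a +ₙ toℕ i ×ₙ d}
    (λ {i} {j} eq → Finₚ.toℕ-injective (term-injective (i<p i) (i<p j) eq))
    λ i → subst (λ r → a +ₙ r ×ₙ d ∈ P) (Finₚ.toℕ-inject≤ i l≤m) (∈range⁺ term (inject≤ i l≤m))
    where
    i<p : ∀ (i : Fin l) → toℕ i < suc p
    i<p i = ℕₚ.<-≤-trans (Finₚ.toℕ<n i) l≤p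

  -- `IsAP` allows repeated terms. If `m ≥ suc p`, the first `suc p` terms would be distinct and
  -- fill the whole group, contradicting `2∣P∣≤p`.
  m≤∣P∣ : m ≤ ∣ P ∣
  m≤∣P∣ with ℕₚ.≤-total m (suc p)
  ... | inj₁ m≤p = initial≤∣P∣ ℕₚ.≤-refl m≤p
  ... | inj₂ p≤m = contradiction
    (ℕₚ.<-≤-trans (ℕₚ.m<m+n ∣ P ∣ (ℕₚ.≤-trans (s≤s z≤n) (ℕₚ.≤-trans 2≤∣P∣ (ℕₚ.m≤m+n ∣ P ∣ 0)))) 2∣P∣≤p)
    (ℕₚ.≤⇒≯ (initial≤∣P∣ p≤m ℕₚ.≤-refl))

  toℕ+toℕ<p : ∀ (i j : Fin m) → toℕ i + toℕ j < suc p
  toℕ+toℕ<p i j = ℕₚ.<-≤-trans (ℕₚ.+-mono-<-≤ (Finₚ.toℕ<n i) (ℕₚ.<⇒≤ (Finₚ.toℕ<n j)))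
    (ℕₚ.≤-trans (ℕₚ.+-mono-≤ m≤∣P∣ (ℕₚ.≤-trans m≤∣P∣ (ℕₚ.m≤m+n ∣ P ∣ 0))) 2∣P∣≤p)

  S : Subset m
  S = ⟦ (λ i → term i ∈? A) ⟧

  x : Fin ∣ S ∣ → Fin (suc p)
  x = term ∘ element S

  x∈A : ∀ i → x i ∈ A
  x∈A i = ∈⟦⟧⁻ (λ i → term i ∈? A) (element-∈ S i)

  ∣A∣≤∣S∣ : ∣ A ∣ ≤ ∣ S ∣
  ∣A∣≤∣S∣ = covered⇒∣∣≤ A x covers
    where
    covers : ∀ {y} → y ∈ A → ∃[ i ] x i ≡ y
    covers y∈A with i , refl ← ∈range⁻ term (A⊆P y∈A)
      with j , eq ← element-surjective (∈⟦⟧⁺ (λ i → term i ∈? A) {i} y∈A) = j , cong term eq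

  sum-reflects : ∀ {i j i′ j′} → x i +ₙ x j ≡ x i′ +ₙ x j′ →
    toℕ (element S i) + toℕ (element S j) ≡ toℕ (element S i′) + toℕ (element S j′)
  sum-reflects {i} {j} {i′} {j′} eq = affine-injective p-prime p∤d (toℕ a + toℕ a)
    (toℕ+toℕ<p (element S i) (element S j)) (toℕ+toℕ<p (element S i′) (element S j′))
    (trans (sym (toℕ-term+term a d (toℕ (element S i)) (toℕ (element S j))))
      (trans (cong toℕ eq) (toℕ-term+term a d (toℕ (element S i′)) (toℕ (element S j′)))))

  open IncreasingSums x (toℕ ∘ element S) (element-mono-< S) (λ {i} {j} → sum-reflects {i} {j})

  ends⊆A : ∀ u → ends u ⊆ A
  ends⊆A u y∈ with s , refl ← ∈range⁻ (x ∘ side u) y∈ = x∈A (side u s)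

-- Real numbers

Lower-≤ : ∀ x {q r} → q ℚ.≤ r → Lower x r → Lower x q
Lower-≤ x {q} {r} q≤r r∈ with ℚₚ.<-cmp q r
... | tri< q<r _ _ = Equivalence.from (lower-rounded x q) (r , q<r , r∈)
... | tri≈ _ refl _ = r∈
... | tri> _ _ r<q = contradiction refl (ℚₚ.<⇒≢ (ℚₚ.<-≤-trans r<q q≤r))

Lower<Upper : ∀ x {q r} → Lower x q → Upper x r → q ℚ.< r
Lower<Upper x q∈ r∈ = ℚₚ.≰⇒> λ r≤q → disjoint x _ (Lower-≤ x r≤q q∈ , r∈)

<ᴿ⇒≤ᴿ : ∀ x y → x <ᴿ y → x ≤ᴿ y
<ᴿ⇒≤ᴿ x y (q , x<q , q<y) r<x = Lower-≤ y (ℚₚ.<⇒≤ (Lower<Upper x r<x x<q)) q<y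

-- The positive reals `ε` and `β` enter the counting through lower bounds of this form, which turn
-- real inequalities into inequalities in `ℕ`.
1/1+_ : ℕ → ℚ
1/1+ D = + 1 ℚ./ suc D

ℕ→ℚ : ℕ → ℚ
ℕ→ℚ m = + m ℚ./ 1

toℚᵘ-/ : ∀ m d → toℚᵘ (+ m ℚ./ suc d) ℚᵘ.≃ mkℚᵘ (+ m) d
toℚᵘ-/ m d = ℚₚ.toℚᵘ-fromℚᵘ (mkℚᵘ (+ m) d)

toℚᵘ-1/1+*ℕ→ℚ : ∀ D m → toℚᵘ (1/1+ D ℚ.* ℕ→ℚ m) ℚᵘ.≃ mkℚᵘ (+ 1) D ℚᵘ.* mkℚᵘ (+ m) 0
toℚᵘ-1/1+*ℕ→ℚ D m = ℚᵘₚ.≃-trans (ℚₚ.toℚᵘ-homo-* (1/1+ D) (ℕ→ℚ m)) (ℚᵘₚ.*-cong (toℚᵘ-/ 1 D) (toℚᵘ-/ m 0))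

ℕ→ℚ≤1/1+*ℕ→ℚ : ∀ {D r m} → r * suc D ≤ m → ℕ→ℚ r ℚ.≤ 1/1+ D ℚ.* ℕ→ℚ m
ℕ→ℚ≤1/1+*ℕ→ℚ {D} {r} {m} rD≤m = ℚₚ.toℚᵘ-cancel-≤ (begin
  toℚᵘ (ℕ→ℚ r)                          ≃⟨ toℚᵘ-/ r 0 ⟩
  mkℚᵘ (+ r) 0                        ≤⟨ ℚᵘ.*≤* (subst₂ ℤ._≤_ lhs rhs (ℤ.+≤+ rD≤m)) ⟩
  mkℚᵘ (+ 1) D ℚᵘ.* mkℚᵘ (+ m) 0      ≃⟨ toℚᵘ-1/1+*ℕ→ℚ D m ⟨
  toℚᵘ (1/1+ D ℚ.* ℕ→ℚ m)               ∎)
  where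
  open ℚᵘₚ.≤-Reasoning
  lhs : + (r * suc D) ≡ + r ℤ.* + suc (D * 1)
  lhs = trans (cong (λ D → + (r * suc D)) (sym (ℕₚ.*-identityʳ D))) (ℤₚ.pos-* r _)
  rhs : + m ≡ (+ 1 ℤ.* + m) ℤ.* + 1
  rhs = trans (sym (ℤₚ.*-identityˡ (+ m))) (sym (ℤₚ.*-identityʳ (+ 1 ℤ.* + m)))

1/1+*ℕ→ℚ+ℕ→ℚ<ℕ→ℚ⇒ : ∀ {D m l} → 1/1+ D ℚ.* ℕ→ℚ m ℚ.+ ℕ→ℚ l ℚ.< ℕ→ℚ m → m + l * suc D < m * suc D
1/1+*ℕ→ℚ+ℕ→ℚ<ℕ→ℚ⇒ {D} {m} {l} lt = ℤₚ.drop‿+<+ (subst₂ ℤ._<_ lhs rhs (ℚᵘₚ.drop-*<* (begin-strict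
  mkℚᵘ (+ 1) D ℚᵘ.* mkℚᵘ (+ m) 0 ℚᵘ.+ mkℚᵘ (+ l) 0 ≃⟨ ℚᵘₚ.+-cong (toℚᵘ-1/1+*ℕ→ℚ D m) (toℚᵘ-/ l 0) ⟨
  toℚᵘ (1/1+ D ℚ.* ℕ→ℚ m) ℚᵘ.+ toℚᵘ (ℕ→ℚ l)           ≃⟨ ℚₚ.toℚᵘ-homo-+ (1/1+ D ℚ.* ℕ→ℚ m) (ℕ→ℚ l) ⟨
  toℚᵘ (1/1+ D ℚ.* ℕ→ℚ m ℚ.+ ℕ→ℚ l)                   <⟨ ℚₚ.toℚᵘ-mono-< lt ⟩
  toℚᵘ (ℕ→ℚ m)                                      ≃⟨ toℚᵘ-/ m 0 ⟩
  mkℚᵘ (+ m) 0                                    ∎)))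
  where
  open ℚᵘₚ.≤-Reasoning
  lhs : ((+ 1 ℤ.* + m) ℤ.* + 1 ℤ.+ + l ℤ.* + suc (D * 1)) ℤ.* + 1 ≡ + (m + l * suc D)
  lhs = trans (ℤₚ.*-identityʳ ((+ 1 ℤ.* + m) ℤ.* + 1 ℤ.+ + l ℤ.* + suc (D * 1))) (trans (cong₂ ℤ._+_
    (trans (ℤₚ.*-identityʳ (+ 1 ℤ.* + m)) (ℤₚ.*-identityˡ (+ m)))
    (trans (sym (ℤₚ.pos-* l _)) (cong (λ D → + (l * suc D)) (ℕₚ.*-identityʳ D))))
    (sym (ℤₚ.pos-+ m (l * suc D))))
  rhs : + m ℤ.* + suc (D * 1 * 1) ≡ + (m * suc D)
  rhs = trans (sym (ℤₚ.pos-* m _))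
    (cong (λ D → + (m * suc D)) (trans (ℕₚ.*-identityʳ (D * 1)) (ℕₚ.*-identityʳ D)))

-- A positive rational below `x` has numerator at least `1`, so it is at least the reciprocal of its
-- own denominator `suc D`.
archimedean : ∀ x → fromℚ 0ℚ <ᴿ x → ∃[ D ] Lower x (1/1+ D)
archimedean x (q@(mkℚ (+[1+ n ]) D _) , _ , q<x) = D , Lower-≤ x (ℚₚ.toℚᵘ-cancel-≤ (begin
  toℚᵘ (1/1+ D)       ≃⟨ toℚᵘ-/ 1 D ⟩
  mkℚᵘ (+ 1) D        ≤⟨ ℚᵘ.*≤* (ℤₚ.*-monoʳ-≤-nonNeg (+ suc D) {+ 1} {+[1+ n ]} (ℤ.+≤+ (s≤s z≤n))) ⟩
  mkℚᵘ (+[1+ n ]) D   ∎)) q<x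
  where open ℚᵘₚ.≤-Reasoning
archimedean x (mkℚ (+ 0) _ _ , 0<q , _) = ⊥-elim (ℤ.Positive.pos (ℚ.positive 0<q))
archimedean x (mkℚ ℤ.-[1+ _ ] _ _ , 0<q , _) = ⊥-elim (ℤ.Positive.pos (ℚ.positive 0<q))

-- The scale `s` is the one built into `suc m · x`, whose cuts at `q` unfold to the cuts of `x` at
-- `q ℚ.* 1/ s`.
module Scaling (m : ℕ) where
  s : ℚ
  s = ℕ→ℚ (suc m)

  instance
    s-pos : ℚ.Positive s
    s-pos = ℚₚ.normalize-pos (suc m) 1

    s-nonZero : ℚ.NonZero s
    s-nonZero = ℚₚ.pos⇒nonZero s

    1/s-pos : ℚ.Positive (1/ s)
    1/s-pos = ℚₚ.1/pos⇒pos s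

  *s*1/s : ∀ q → q ℚ.* s ℚ.* 1/ s ≡ q
  *s*1/s q = trans (ℚₚ.*-assoc q s (1/ s))
    (trans (cong (q ℚ.*_) (ℚₚ.*-inverseʳ s)) (ℚₚ.*-identityʳ q))

  *1/s*s : ∀ q → q ℚ.* 1/ s ℚ.* s ≡ q
  *1/s*s q = trans (ℚₚ.*-assoc q (1/ s) s)
    (trans (cong (q ℚ.*_) (ℚₚ.*-inverseˡ s)) (ℚₚ.*-identityʳ q))

-- For `m > 0`, `q < r` and `r * suc D ≤ m` give `q / m < 1 / (D + 1)`, and lower cuts are downward
-- closed. For `m = 0` the bound forces `r = 0`, and `zero · x` is `0` by definition.
≤ᴿ-· : ∀ m x D r → Lower x (1/1+ D) → r * suc D ≤ m → fromℕ r ≤ᴿ m · x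
≤ᴿ-· zero    x D zero D∈ rD≤m q<r = q<r
≤ᴿ-· (suc m) x D r    D∈ rD≤m {q} q<r = Lower-≤ x (begin
  q ℚ.* 1/ s                ≤⟨ ℚₚ.<⇒≤ (ℚₚ.*-monoˡ-<-pos (1/ s) q<r) ⟩
  ℕ→ℚ r ℚ.* 1/ s            ≤⟨ ℚₚ.*-monoʳ-≤-nonNeg (1/ s) {{ℚₚ.pos⇒nonNeg (1/ s)}}
                                 (ℕ→ℚ≤1/1+*ℕ→ℚ {D} {r} rD≤m) ⟩
  1/1+ D ℚ.* s ℚ.* 1/ s     ≡⟨ *s*1/s (1/1+ D) ⟩
  1/1+ D                    ∎) D∈
  where
  open Scaling m
  open ℚₚ.≤-Reasoning

-- Serves both size-ratio conditions of `Stable` when `α = 1` and `B` is `A`.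
·1≤ᴿ : ∀ m → m · fromℚ 1ℚ ≤ᴿ fromℕ m
·1≤ᴿ zero    q<0 = q<0
·1≤ᴿ (suc m) {q} q/s<1 = subst₂ ℚ._<_ (*1/s*s q) (ℚₚ.*-identityˡ s) (ℚₚ.*-monoˡ-<-pos s q/s<1)
  where open Scaling m

-- As `1/1+ D` lies below `β`, the hypothesis gives `l < m − m / (D + 1)`; the conclusion is this
-- multiplied by `suc D` and rearranged to avoid subtraction.
<ᴿ-·1- : ∀ m β D l → Lower β (1/1+ D) → fromℕ l <ᴿ m · (1- β) → m + l * suc D < m * suc D
<ᴿ-·1- zero    β D l D∈ (q , l<q , q<0) = contradiction refl (ℚₚ.<⇒≢ (ℚₚ.≤-<-trans
  (ℚₚ.nonNegative⁻¹ (ℕ→ℚ l) {{ℚₚ.normalize-nonNeg l 1}}) (ℚₚ.<-trans l<q q<0)))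
<ᴿ-·1- (suc m) β D l D∈ (q , l<q , β<1-q/s) = 1/1+*ℕ→ℚ+ℕ→ℚ<ℕ→ℚ⇒ {D} {suc m} {l} (begin-strict
  1/1+ D ℚ.* s ℚ.+ ℕ→ℚ l                       <⟨ ℚₚ.+-monoʳ-< (1/1+ D ℚ.* s) l<q ⟩
  1/1+ D ℚ.* s ℚ.+ q                           ≡⟨ cong (λ q → 1/1+ D ℚ.* s ℚ.+ q) (*1/s*s q) ⟨
  1/1+ D ℚ.* s ℚ.+ q ℚ.* 1/ s ℚ.* s            ≡⟨ ℚₚ.*-distribʳ-+ s (1/1+ D) (q ℚ.* 1/ s) ⟨
  (1/1+ D ℚ.+ q ℚ.* 1/ s) ℚ.* s                <⟨ ℚₚ.*-monoˡ-<-pos s (ℚₚ.+-monoˡ-< (q ℚ.* 1/ s)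
                                                    (Lower<Upper β D∈ β<1-q/s)) ⟩
  (1ℚ ℚ.- q ℚ.* 1/ s ℚ.+ q ℚ.* 1/ s) ℚ.* s     ≡⟨ cong (ℚ._* s) (1-q+q (q ℚ.* 1/ s)) ⟩
  1ℚ ℚ.* s                                     ≡⟨ ℚₚ.*-identityˡ s ⟩
  s                                            ∎)
  where
  open Scaling m
  open ℚₚ.≤-Reasoning

  1-q+q : ∀ q → 1ℚ ℚ.- q ℚ.+ q ≡ 1ℚ
  1-q+q = solve 1 (λ q → con 1ℚ :- q :+ q := con 1ℚ) refl
    where open +-*-Solver

-- The stability argument

-- With `t = suc D * suc E * k`, each product is at most `k * a` for some `a ≤ t`, hence at most
-- `t² ≤ n`. In turn the bounds make the sets of ends disjoint, give `r ≤ ε n` for stability, and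
-- prevent wraparound.
square-bounds : ∀ D E {k n} → 2 ≤ k → (suc D * suc E * k) ^ 2 ≤ n →
  2 * k ≤ n × k * (k ∸ 1) * suc D ≤ n × k * (k ∸ 1) * suc E ≤ n
square-bounds D E {k} {n} 2≤k t²≤n =
  ℕₚ.≤-trans (ℕₚ.*-mono-≤ 2≤k ℕₚ.≤-refl) (below (ℕₚ.m≤n*m k (suc D * suc E))) ,
  scaled D (subst (k * suc D ≤_) (rotate k (suc D) (suc E)) (ℕₚ.m≤m*n (k * suc D) (suc E))) ,
  scaled E (subst (k * suc E ≤_) (trans (rotate k (suc E) (suc D)) (cong (_* k) (ℕₚ.*-comm (suc E) (suc D))))
    (ℕₚ.m≤m*n (k * suc E) (suc D)))
  where
  t : ℕ
  t = suc D * suc E * k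

  below : ∀ {a} → a ≤ t → k * a ≤ n
  below a≤t = ℕₚ.≤-trans (ℕₚ.*-mono-≤ (ℕₚ.m≤n*m k (suc D * suc E)) a≤t)
    (subst (_≤ n) (cong (t *_) (ℕₚ.*-identityʳ t)) t²≤n)

  rotate : ∀ k d e → k * d * e ≡ d * e * k
  rotate = solve-∀

  scaled : ∀ D → k * suc D ≤ t → k * (k ∸ 1) * suc D ≤ n
  scaled D kD≤t = ℕₚ.≤-trans
    (ℕₚ.≤-reflexive (ℕₚ.*-assoc k (k ∸ 1) (suc D)))
    (below (ℕₚ.≤-trans (ℕₚ.*-monoˡ-≤ (suc D) (ℕₚ.m∸n≤m k 1)) kD≤t))

-- `gap` says `2n < p − p / (E + 1)`, and this slack absorbs `2r ≤ 2n / (E + 1) ≤ p / (E + 1)`.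
no-wraparound : ∀ {n r p} E → p + 2 * n * suc E < p * suc E → r * suc E ≤ n → 2 * (n + r) ≤ p
no-wraparound {n} {r} {p} E gap rE≤n = ℕₚ.*-cancelʳ-≤ (2 * (n + r)) p (suc E) (begin
  2 * (n + r) * suc E               ≡⟨ expand n r (suc E) ⟩
  2 * n * suc E + 2 * (r * suc E)   ≤⟨ ℕₚ.+-monoʳ-≤ (2 * n * suc E) (ℕₚ.*-monoʳ-≤ 2 rE≤n) ⟩
  2 * n * suc E + 2 * n             ≤⟨ ℕₚ.+-monoʳ-≤ (2 * n * suc E) 2n≤p ⟩
  2 * n * suc E + p                 ≡⟨ ℕₚ.+-comm (2 * n * suc E) p ⟩
  p + 2 * n * suc E                 ≤⟨ ℕₚ.<⇒≤ gap ⟩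
  p * suc E                         ∎)
  where
  open ℕₚ.≤-Reasoning

  expand : ∀ n r e → 2 * (n + r) * e ≡ 2 * n * e + 2 * (r * e)
  expand = solve-∀

  2n≤p : 2 * n ≤ p
  2n≤p = ℕₚ.*-cancelʳ-≤ (2 * n) p (suc E) (ℕₚ.≤-trans (ℕₚ.m≤n+m (2 * n * suc E) p) (ℕₚ.<⇒≤ gap))

k*[k∸1]<k*k : ∀ {k} → 2 ≤ k → k * (k ∸ 1) < k * k
k*[k∸1]<k*k {suc k} _ = ℕₚ.*-monoʳ-< (suc k) ℕₚ.≤-refl

-- A failing `B` has at most `2n − 2k` restricted sums, and restoring the forbidden pairs adds at
-- most `r`; `k ≥ 1` brings the total under `2n − 1 + r`.
∣⊕∣-bound : ∀ {p} (A B : Subset p) (F : PairSet p) {n k r} → 1 ≤ n → 1 ≤ k → ∣ F ∣ ≤ r →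
  ¬ (2 * n + 1 ≤ ∣ A ⊕[ F ] B ∣ + 2 * k) →
  + ∣ A ⊕ B ∣ ℤ.≤ + n ℤ.+ + n ℤ.- + 1 ℤ.+ + r
-- Writing the size as `suc n` lets the integer bound compute to the natural number `n + suc n + r`.
∣⊕∣-bound A B F {suc n} {k} {r} _ 1≤k ∣F∣≤r ¬large = ℤ.+≤+ (ℕₚ.+-cancelʳ-≤ 1 ∣ A ⊕ B ∣ _ (begin
  ∣ A ⊕ B ∣ + 1                      ≤⟨ ℕₚ.+-mono-≤ (∣⊕∣≤∣⊕[]∣+∣∣ A F B) (ℕₚ.≤-trans 1≤k (ℕₚ.m≤m+n k _)) ⟩
  ∣ A ⊕[ F ] B ∣ + ∣ F ∣ + 2 * k     ≡⟨ swap ∣ A ⊕[ F ] B ∣ ∣ F ∣ (2 * k) ⟩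
  ∣ A ⊕[ F ] B ∣ + 2 * k + ∣ F ∣     ≤⟨ ℕₚ.+-mono-≤ small ∣F∣≤r ⟩
  2 * suc n + r                      ≡⟨ regroup n r ⟩
  n + suc n + r + 1                  ∎))
  where
  open ℕₚ.≤-Reasoning

  small : ∣ A ⊕[ F ] B ∣ + 2 * k ≤ 2 * suc n
  small = s≤s⁻¹ (subst (∣ A ⊕[ F ] B ∣ + 2 * k <_) (ℕₚ.+-comm (2 * suc n) 1) (ℕₚ.≰⇒> ¬large))

  swap : ∀ a b c → a + b + c ≡ a + c + b
  swap = solve-∀

  regroup : ∀ n r → 2 * suc n + r ≡ n + suc n + r + 1
  regroup = solve-∀

range⊆ : ∀ {c n} {A : Subset n} (b : Fin c → Fin n) → (∀ i → b i ∈ A) → range b ⊆ A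
range⊆ b b∈A x∈ with i , refl ← ∈range⁻ b x∈ = b∈A i

∃-large-restricted-sum-of-stable : ∀ c ε β D E k p → 2 ≤ c → Stable c ε (fromℚ 1ℚ) β →
  Lower ε (1/1+ D) → Lower β (1/1+ E) → 2 ≤ k → Prime p → (A : Subset p) →
  (suc D * suc E * k) ^ 2 ≤ ∣ A ∣ → fromℕ (2 * ∣ A ∣) <ᴿ p · (1- β) →
  (F : PairSet p) → ∣ F ∣ ≤ k * (k ∸ 1) →
  ∃[ B ] B ⊆ A × ∣ B ∣ ≤ c × 2 * ∣ A ∣ + 1 ≤ ∣ A ⊕[ F ] B ∣ + 2 * k
∃-large-restricted-sum-of-stable c ε β D E k p 2≤c stable D∈ε E∈β 2≤k p-prime A k-small 2n<p
  F ∣F∣≤r =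
  -- There are finitely many subsets, so the existence of `B` is decidable and the argument may
  -- assume that none works.
  decide (anySubset? (λ B → B ⊆? A ×-dec ∣ B ∣ ≤? c ×-dec 2 * n + 1 ≤? ∣ A ⊕[ F ] B ∣ + 2 * k))
  where
  n = ∣ A ∣
  r = k * (k ∸ 1)

  Large : Subset p → Set
  Large B = B ⊆ A × ∣ B ∣ ≤ c × 2 * n + 1 ≤ ∣ A ⊕[ F ] B ∣ + 2 * k

  bounds : 2 * k ≤ n × r * suc D ≤ n × r * suc E ≤ n
  bounds = square-bounds D E 2≤k k-small

  2≤n : 2 ≤ n
  2≤n = ℕₚ.≤-trans 2≤k (ℕₚ.≤-trans (ℕₚ.m≤m+n k (k + 0)) (proj₁ bounds))

  progression : ¬ (∃[ B ] Large B) → ∃[ P ] IsAP P × A ⊆ P × + ∣ P ∣ ≡ + n ℤ.+ + r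
  progression ¬∃Large = stable p p-prime A A 2≤n 2≤n (·1≤ᴿ n) (·1≤ᴿ n)
    (subst (λ m → fromℕ m ≤ᴿ p · (1- β)) (cong (λ m → n + m) (ℕₚ.+-identityʳ n))
      (<ᴿ⇒≤ᴿ (fromℕ (2 * n)) (p · (1- β)) 2n<p))
    (+ r) (≤ᴿ-· n ε D r D∈ε (proj₁ (proj₂ bounds)))
    -- Any `c` elements of `A` form a candidate `range b` of size at most `c`; its failure bounds
    -- the unrestricted sumset.
    λ b b∈A → ∣⊕∣-bound A (range b) F (ℕₚ.<⇒≤ 2≤n) (ℕₚ.<⇒≤ 2≤k) ∣F∣≤r
      λ large → ¬∃Large (range b , range⊆ b b∈A , ∣range∣≤ b , large)

  from-progression : ∃[ P ] IsAP P × A ⊆ P × + ∣ P ∣ ≡ + n ℤ.+ + r → ∃[ B ] Large B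
  from-progression (P , P-ap , A⊆P , ∣P∣≡n+r) =
    let B , B⊆A , ∣B∣≤2 , large = ∃-large-restricted-sum p-prime A P P-ap A⊆P 2≤n
          (subst (λ m → 2 * m ≤ p) (sym (ℤₚ.+-injective ∣P∣≡n+r))
            (no-wraparound E (<ᴿ-·1- p β E (2 * n) E∈β 2n<p) (proj₂ (proj₂ bounds))))
          F k (proj₁ bounds) (ℕₚ.≤-<-trans ∣F∣≤r (k*[k∸1]<k*k 2≤k))
    in B , B⊆A , ℕₚ.≤-trans ∣B∣≤2 2≤c , large

  decide : Dec (∃[ B ] Large B) → ∃[ B ] Large B
  decide (yes found)  = found
  decide (no ¬∃Large) = from-progression (progression ¬∃Large)

theorem36 : (k : ℕ → ℕ) → (∀ n → 2 ≤ k n) → IsLittleO√ k →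
    (β : ℝ) → fromℚ 0ℚ <ᴿ β → β <ᴿ fromℚ ½ →
    (c : ℕ) → 2 ≤ c →
    (ε : ℝ) → fromℚ 0ℚ <ᴿ ε → ε <ᴿ fromℚ ½ →
    Stable c ε (fromℚ 1ℚ) β →
    ∃[ N ] ∀ n → N ≤ n →
    ∀ p → Prime p → (A : Subset p) → ∣ A ∣ ≡ n → fromℕ (2 * n) <ᴿ p · (1- β) →
    (F : PairSet p) → F ⊆ A ×ˢ A → ∣ F ∣ ≤ k n * (k n ∸ 1) →
    ∃[ B′ ] B′ ⊆ A × ∣ B′ ∣ ≤ c × 2 * n + 1 ≤ ∣ A ⊕[ F ] B′ ∣ + 2 * k n
theorem36 k 2≤k k=o√ β 0<β _ c 2≤c ε 0<ε _ stable =
  let D , D∈ε = archimedean ε 0<ε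
      E , E∈β = archimedean β 0<β
      -- This multiplier makes `k n` small against both `ε` and `β`, so one threshold `N` serves
      -- both.
      N , k-small = k=o√ (suc D * suc E)
  in N , λ { n N≤n p p-prime A refl 2n<p F _ ∣F∣≤ →
    ∃-large-restricted-sum-of-stable c ε β D E (k n) p 2≤c stable D∈ε E∈β (2≤k n)
      p-prime A (k-small n N≤n) 2n<p F ∣F∣≤ }
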